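{- If $n$ is a product of exactly $2$ or exactly $3$ primes, not necessarily distinct (i.e., $n=pq$ or $n=pqr$ with $p,q,r$ prime), then the $n\times n$ square has no perfect Mondrian partition.
   Context: A Mondrian partition of an $n\times n$ square ($n$ a positive integer) is a dissection of the square into $k\ge 2$ non-overlapping rectangles with positive integer side lengths which are pairwise non-congruent (rectangles of dimensions $a\times b$ and $b\times a$ count as congruent). It is perfect if all its rectangles have the same area. -}

module Defs where

open import Data.Nat using (ℕ; _+_; _*_; _≤_; _<_)
open import Data.Fin using (Fin)
open import Data.Product using (_×_; ∃-syntax)
open import Data.Sum using (_⊎_)
open import Relation.Nullary using (¬_)
open import Relation.Binary.PropositionalEquality using (_≡_; _≢_)

-- An axis-parallel rectangle [left, left + width] × [bottom, bottom + height].
-- Restricting to corners in ℕ² loses nothing: in a dissection of [0, n]² the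
-- left side of a rectangle lies on x = 0 or touches the right side of another
-- rectangle, so integer side lengths force integer corners (likewise for y).
record Rectangle : Set where
  field
    left bottom width height : ℕ
    0<width  : 0 < width
    0<height : 0 < height

  area : ℕ
  area = width * height

open Rectangle public

-- The unit cell [x, x + 1] × [y, y + 1] is contained in R.
CellIn : ℕ → ℕ → Rectangle → Set
CellIn x y R =
  (left R ≤ x × x < left R + width R) ×
  (bottom R ≤ y × y < bottom R + height R)

-- For rectangles with integer corners, disjointness of the interiors is
-- equivalent to having no common unit cell.
NonOverlapping : Rectangle → Rectangle → Set
NonOverlapping R S = ∀ x y → ¬ (CellIn x y R × CellIn x y S)

Congruent : Rectangle → Rectangle → Set
Congruent R S =
  (width R ≡ width S × height R ≡ height S) ⊎
  (width R ≡ height S × height R ≡ width S)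

InSquare : ℕ → Rectangle → Set
InSquare n R = left R + width R ≤ n × bottom R + height R ≤ n

record MondrianPartition (n : ℕ) : Set where
  field
    k              : ℕ
    2≤k            : 2 ≤ k
    tile           : Fin k → Rectangle
    inSquare       : ∀ i → InSquare n (tile i)
    covers         : ∀ x y → x < n → y < n → ∃[ i ] CellIn x y (tile i)
    nonOverlapping : ∀ i j → i ≢ j → NonOverlapping (tile i) (tile j)
    nonCongruent   : ∀ i j → i ≢ j → ¬ Congruent (tile i) (tile j)

Perfect : ∀ {n} → MondrianPartition n → Set
Perfect P = ∀ i j → area (tile i) ≡ area (tile j)
  where open MondrianPartition P

{-# OPTIONS --safe #-}

-- Counting cells gives k A = n² for k tiles of area A. A tile is determined up
-- to congruence by one of its sides, so k is at most the size of any list L of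
-- numbers such that every factorisation A = w h with w, h ≤ n has a factor in L.
-- Splitting by the number Ω(k) of prime factors of k, such lists show k ≤ 3:
--   * k = r and n = r m: one side is r u with u ∣ m² and u ≤ m;
--   * k = r² and n = r m: one side u satisfies u ∣ m² and u ≤ m;
--   * k = r s with r ≠ s and n = r s t: five sides suffice, but k ≥ 6;
--   * otherwise Ω(A) ≤ Ω(k), and A has at most 2^(Ω(A) − 1) unordered
--     factorisations (one, if A = 1), fewer than k ≥ 2^Ω(k).
-- If k ≤ 3, two of the four corner cells lie in the same tile, which therefore
-- spans the square; the rest is then filled by tiles congruent to it or to each
-- other.
module Submission where

open import Data.Nat using (ℕ; suc; pred; _+_; _*_; _∸_; _^_; _≤_; _<_; z≤n; s≤s; NonZero; >-nonZero; >-nonZero⁻¹; nonTrivial⇒n>1)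
open import Data.Nat.Properties
open import Data.Nat.Divisibility using (_∣_; divides; m∣m*n; ∣-trans)
open import Data.Nat.ListAction using (product)
open import Data.Nat.ListAction.Properties using (product-++)
open import Data.Nat.Primality using (Prime; prime?; euclidsLemma; prime⇒irreducible; prime⇒nonTrivial; prime⇒nonZero; ¬prime[1])
open import Data.Nat.Tactic.RingSolver using (solve-∀)
open import Data.Fin using (Fin; zero; suc; toℕ; fromℕ<; combine; remQuot; cast)
open import Data.Fin.Properties as Fin using (pigeonhole; injective⇒≤; combine-injective; combine-remQuot; fromℕ<-injective; toℕ-injective; toℕ<n)
open import Data.List using (List; []; _∷_; _++_; map; length; lookup)
open import Data.List.Properties using (length-++; length-map)
open import Data.List.Membership.Propositional using (_∈_)
open import Data.List.Membership.Propositional.Properties using (∈-map⁺; ∈-++⁺ˡ; ∈-++⁺ʳ)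
open import Data.List.Relation.Unary.All using (All; []; _∷_)
import Data.List.Relation.Unary.All.Properties as All
open import Data.List.Relation.Unary.Any using (here; there; index)
open import Data.List.Relation.Unary.Any.Properties using (lookup-index)
open import Data.Vec as Vec using (_∷_; [])
open import Data.Product using (_×_; _,_; ∃-syntax; proj₁; proj₂; uncurry; swap)
open import Data.Sum as Sum using (_⊎_; inj₁; inj₂; [_,_]′)
open import Data.Empty using (⊥)
open import Function using (_∘_; id)
open import Relation.Nullary using (¬_; yes; no; contradiction)
open import Relation.Nullary.Decidable using (from-no; decidable-stable)
open import Relation.Binary.PropositionalEquality using (_≡_; _≢_; refl; sym; trans; cong; cong₂; subst; subst₂; module ≡-Reasoning)
open import Defs

private variable
  p q r s t n : ℕ
  ps : List ℕ

-- Primes and factorisations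

prime⇒2≤ : Prime p → 2 ≤ p
prime⇒2≤ pp = nonTrivial⇒n>1 _ {{prime⇒nonTrivial pp}}

prime≤4⇒≤3 : Prime p → p ≤ 4 → p ≤ 3
prime≤4⇒≤3 pp p≤4 with m≤n⇒m<n∨m≡n p≤4
... | inj₁ (s≤s p≤3) = p≤3
... | inj₂ refl      = contradiction pp (from-no (prime? 4))

prime∣prime⇒≡ : Prime r → Prime p → r ∣ p → r ≡ p
prime∣prime⇒≡ pr pp r∣p with prime⇒irreducible pp r∣p
... | inj₁ refl = contradiction pr ¬prime[1]
... | inj₂ r≡p  = r≡p

-- Euclid's lemma with the prime cancelled from the factor that it divides. Repeating this on the
-- remaining equation classifies all divisors of a number given by its primes.
prime-split : ∀ x y z → Prime p → x * y ≡ p * z →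
              (∃[ x′ ] (x ≡ p * x′ × x′ * y ≡ z)) ⊎ (∃[ y′ ] (y ≡ p * y′ × x * y′ ≡ z))
prime-split {p} x y z pp eq
  with euclidsLemma x y pp (subst (p ∣_) (sym eq) (m∣m*n z))
... | inj₁ (divides x′ refl) = inj₁ (x′ , *-comm x′ p ,
        *-cancelˡ-≡ _ _ p {{prime⇒nonZero pp}} (trans (lemma p x′ y) eq))
  where
  lemma : ∀ p x y → p * (x * y) ≡ x * p * y
  lemma = solve-∀
... | inj₂ (divides y′ refl) = inj₂ (y′ , *-comm y′ p ,
        *-cancelˡ-≡ _ _ p {{prime⇒nonZero pp}} (trans (lemma p x y′) eq))
  where
  lemma : ∀ p x y → p * (x * y) ≡ x * (y * p)
  lemma = solve-∀

-- Two rounds of `prime-split` distribute both copies of `p`. When `z` is 1, the three cases list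
-- the divisors of p².
prime-square-split : ∀ x y z → Prime p → x * y ≡ p * (p * z) →
                     ∃[ x′ ] ∃[ y′ ] (x′ * y′ ≡ z × (x ≡ x′ ⊎ x ≡ p * x′ ⊎ x ≡ p * (p * x′)))
prime-square-split {p} x y z pp eq with prime-split x y (p * z) pp eq
... | inj₁ (x₁ , refl , eq₁) with prime-split x₁ y z pp eq₁
...   | inj₁ (x₂ , refl , eq₂) = x₂ , _ , eq₂ , inj₂ (inj₂ refl)
...   | inj₂ (y₂ , refl , eq₂) = x₁ , _ , eq₂ , inj₂ (inj₁ refl)
prime-square-split {p} x y z pp eq | inj₂ (y₁ , refl , eq₁) with prime-split x y₁ z pp eq₁
...   | inj₁ (x₂ , refl , eq₂) = x₂ , _ , eq₂ , inj₂ (inj₁ refl)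
...   | inj₂ (y₂ , refl , eq₂) = _ , y₂ , eq₂ , inj₁ refl

-- Each prime of the list goes to one of the two factors. The length equation is additivity of Ω,
-- which later links the number of tiles with their area.
product-split : ∀ x y → All Prime ps → x * y ≡ product ps →
                ∃[ xs ] ∃[ ys ] (All Prime xs × All Prime ys × x ≡ product xs × y ≡ product ys
                                 × length xs + length ys ≡ length ps)
product-split x y [] eq =
  [] , [] , [] , [] , m*n≡1⇒m≡1 x y eq , m*n≡1⇒n≡1 x y eq , refl
product-split {p ∷ ps} x y (pp ∷ pps) eq with prime-split x y (product ps) pp eq
... | inj₁ (x′ , refl , eq′) with product-split x′ y pps eq′
...   | xs , ys , pxs , pys , refl , refl , len =
        p ∷ xs , ys , pp ∷ pxs , pys , refl , refl , cong suc len
product-split {p ∷ ps} x y (pp ∷ pps) eq | inj₂ (y′ , refl , eq′) with product-split x y′ pps eq′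
...   | xs , ys , pxs , pys , refl , refl , len =
        xs , p ∷ ys , pxs , pp ∷ pys , refl , refl , trans (+-suc (length xs) _) (cong suc len)

-- All subproducts, with repetitions when primes repeat, so that the length is exactly 2^Ω.
divisors : List ℕ → List ℕ
divisors []       = 1 ∷ []
divisors (p ∷ ps) = divisors ps ++ map (p *_) (divisors ps)

length-divisors : ∀ ps → length (divisors ps) ≡ 2 ^ length ps
length-divisors []       = refl
length-divisors (p ∷ ps) = begin
  length (divisors ps ++ map (p *_) (divisors ps))          ≡⟨ length-++ (divisors ps) ⟩
  length (divisors ps) + length (map (p *_) (divisors ps))  ≡⟨ cong (length (divisors ps) +_) (length-map _ (divisors ps)) ⟩
  length (divisors ps) + length (divisors ps)               ≡⟨ cong₂ _+_ (length-divisors ps) (trans (length-divisors ps) (sym (+-identityʳ _))) ⟩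
  2 ^ length (p ∷ ps)                                       ∎
  where open ≡-Reasoning

divisor∈divisors : ∀ x y → All Prime ps → x * y ≡ product ps → x ∈ divisors ps
divisor∈divisors x y [] eq = here (m*n≡1⇒m≡1 x y eq)
divisor∈divisors {p ∷ ps} x y (pp ∷ pps) eq with prime-split x y (product ps) pp eq
... | inj₁ (x′ , refl , eq′) = ∈-++⁺ʳ (divisors ps) (∈-map⁺ (p *_) (divisor∈divisors x′ y pps eq′))
... | inj₂ (y′ , refl , eq′) = ∈-++⁺ˡ (divisor∈divisors x y′ pps eq′)

2^length≤product : All Prime ps → 2 ^ length ps ≤ product ps
2^length≤product []         = ≤-refl
2^length≤product (pp ∷ pps) = *-mono-≤ (prime⇒2≤ pp) (2^length≤product pps)

extract-prime : Prime r → All Prime ps → r ∣ product ps →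
                ∃[ qs ] (All Prime qs × product ps ≡ r * product qs × length ps ≡ suc (length qs))
extract-prime pr [] r∣1 = contradiction (subst Prime (1∣ r∣1) pr) ¬prime[1]
  where
  1∣ : r ∣ 1 → r ≡ 1
  1∣ {r} (divides c eq) = m*n≡1⇒n≡1 c r (sym eq)
extract-prime {r} {p ∷ ps} pr (pp ∷ pps) r∣ with euclidsLemma p (product ps) pr r∣
... | inj₁ r∣p with refl ← prime∣prime⇒≡ pr pp r∣p = ps , pps , refl , refl
... | inj₂ r∣ps with extract-prime pr pps r∣ps
...   | qs , pqs , eq , len = p ∷ qs , pp ∷ pqs ,
        trans (cong (p *_) eq) (lemma p r (product qs)) , cong suc len
  where
  lemma : ∀ p r z → p * (r * z) ≡ r * (p * z)
  lemma = solve-∀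

prime∣square⇒∣ : ∀ n → Prime r → r ∣ n * n → r ∣ n
prime∣square⇒∣ n pr r∣nn = [ id , id ]′ (euclidsLemma n n pr r∣nn)

-- Divisors of a square below its root

-- Serves to discard a small divisor `e` of m²: if `e * c` is below `m`, the opposite side `v`
-- exceeds `c * m`, the side of the square.
cofactor-bound : ∀ m e v c → .{{NonZero m}} → e * v ≡ m * m → v ≤ c * m → m ≤ e * c
cofactor-bound m e v c eq v≤ = *-cancelʳ-≤ m (e * c) m (begin
  m * m        ≡⟨ eq ⟨
  e * v        ≤⟨ *-monoʳ-≤ e v≤ ⟩
  e * (c * m)  ≡⟨ *-assoc e c m ⟨
  e * c * m    ∎)
  where open ≤-Reasoning

x*m≰m : ∀ x m → 2 ≤ x → .{{NonZero m}} → ¬ (x * m ≤ m)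
x*m≰m x m 2≤x le = <⇒≱ 2≤x (*-cancelʳ-≤ x 1 m (subst (x * m ≤_) (sym (*-identityˡ m)) le))

small-divisor-prime-square : ∀ u v → Prime p → u * v ≡ p * p → u ≤ p → u ∈ p ∷ 1 ∷ []
small-divisor-prime-square {p} u v pp eq u≤p
  with prime-square-split u v 1 pp (trans eq (cong (p *_) (sym (*-identityʳ p))))
... | u′ , v′ , eq′ , c with refl ← m*n≡1⇒m≡1 u′ v′ eq′ with c
...   | inj₁ refl        = there (here refl)
...   | inj₂ (inj₁ refl) = here (*-identityʳ p)
...   | inj₂ (inj₂ refl) = contradiction (subst (λ z → p * z ≤ p) (*-identityʳ p) u≤p)
                             (x*m≰m p p (prime⇒2≤ pp) {{prime⇒nonZero pp}})

-- The divisors of p²q² come in pairs with product p²q², so at most five of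
-- them are at most pq.
small-divisor-semiprime-square : ∀ u v → Prime p → Prime q → q ≤ p →
  u * v ≡ (p * q) * (p * q) → u ≤ p * q → u ∈ p * q ∷ p ∷ q ∷ q * q ∷ 1 ∷ []
small-divisor-semiprime-square {p} {q} u v pp pq q≤p eq u≤
  with prime-square-split u v (q * (q * 1)) pp (trans eq (lemma p q))
  where
  lemma : ∀ p q → (p * q) * (p * q) ≡ p * (p * (q * (q * 1)))
  lemma = solve-∀
... | u₁ , v₁ , eq₁ , c with prime-square-split u₁ v₁ 1 pq eq₁
...   | u₂ , v₂ , eq₂ , d with refl ← m*n≡1⇒m≡1 u₂ v₂ eq₂ = go c d u≤
  where
  instance
    _ = prime⇒nonZero pp
    _ = prime⇒nonZero pq
    _ = m*n≢0 p q
  2≤p = prime⇒2≤ pp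
  2≤q = prime⇒2≤ pq
  go : ∀ {u u₁} → (u ≡ u₁ ⊎ u ≡ p * u₁ ⊎ u ≡ p * (p * u₁)) →
       (u₁ ≡ 1 ⊎ u₁ ≡ q * 1 ⊎ u₁ ≡ q * (q * 1)) → u ≤ p * q →
       u ∈ p * q ∷ p ∷ q ∷ q * q ∷ 1 ∷ []
  go (inj₁ refl)        (inj₁ refl)        _  = there (there (there (there (here refl))))
  go (inj₁ refl)        (inj₂ (inj₁ refl)) _  = there (there (here (*-identityʳ q)))
  go (inj₁ refl)        (inj₂ (inj₂ refl)) _  = there (there (there (here (cong (q *_) (*-identityʳ q)))))
  go (inj₂ (inj₁ refl)) (inj₁ refl)        _  = there (here (*-identityʳ p))
  go (inj₂ (inj₁ refl)) (inj₂ (inj₁ refl)) _  = here (cong (p *_) (*-identityʳ q))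
  go (inj₂ (inj₁ refl)) (inj₂ (inj₂ refl)) le =
    contradiction (≤-trans (≤-reflexive (lemma p q)) le) (x*m≰m q (p * q) 2≤q)
    where
    lemma : ∀ p q → q * (p * q) ≡ p * (q * (q * 1))
    lemma = solve-∀
  -- The divisor p² is at most pq only if p = q, and then it is the list entry pq.
  go (inj₂ (inj₂ refl)) (inj₁ refl)        le =
    here (cong (p *_) (trans (*-identityʳ p) (≤-antisym p≤q q≤p)))
    where
    p≤q : p ≤ q
    p≤q = *-cancelˡ-≤ p (subst (λ z → p * z ≤ p * q) (*-identityʳ p) le)
  go (inj₂ (inj₂ refl)) (inj₂ (inj₁ refl)) le =
    contradiction (≤-trans (≤-reflexive (lemma p q)) le) (x*m≰m p (p * q) 2≤p)
    where
    lemma : ∀ p q → p * (p * q) ≡ p * (p * (q * 1))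
    lemma = solve-∀
  go (inj₂ (inj₂ refl)) (inj₂ (inj₂ refl)) le =
    contradiction (≤-trans (≤-reflexive (lemma p q)) le) (x*m≰m (p * q) (p * q) (*-mono-≤ 2≤p (>-nonZero⁻¹ q)))
    where
    lemma : ∀ p q → p * q * (p * q) ≡ p * (p * (q * (q * 1)))
    lemma = solve-∀

-- The case q = p of the preceding lemma. Repeated entries are removed because the length of the
-- list becomes the bound on the number of tiles.
small-divisor-prime-fourth-power : ∀ u v → Prime p →
  u * v ≡ (p * p) * (p * p) → u ≤ p * p → u ∈ p * p ∷ p ∷ 1 ∷ []
small-divisor-prime-fourth-power {p} u v pp eq u≤ =
  dedup (small-divisor-semiprime-square u v pp pp ≤-refl eq u≤)
  where
  dedup : u ∈ p * p ∷ p ∷ p ∷ p * p ∷ 1 ∷ [] → u ∈ p * p ∷ p ∷ 1 ∷ []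
  dedup (here e)                          = here e
  dedup (there (here e))                  = there (here e)
  dedup (there (there (here e)))          = there (here e)
  dedup (there (there (there (here e))))  = here e
  dedup (there (there (there (there e)))) = there (there e)

x*y≡m*m⇒x≤m : ∀ x y m → x ≤ y → x * y ≡ m * m → x ≤ m
x*y≡m*m⇒x≤m x y m x≤y eq = ≮⇒≥ λ m<x → <⇒≢ (*-mono-< m<x (<-≤-trans m<x x≤y)) (sym eq)

-- Bounds on the number of tiles from lists of sides

SidesIn : ℕ → ℕ → List ℕ → Set
SidesIn n A L = ∀ w h → w * h ≡ A → w ≤ n → h ≤ n → w ∈ L ⊎ h ∈ L

-- The prime `a` divides one of the two sides. By symmetry this may be taken to be the first, so
-- each unordered factorisation is examined in the form (a u) v.
sidesIn-prime : ∀ {a L} B → Prime a →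
  (∀ u v → u * v ≡ B → a * u ≤ n → v ≤ n → a * u ∈ L ⊎ v ∈ L) → SidesIn n (a * B) L
sidesIn-prime B pa f w h eq w≤n h≤n with prime-split w h B pa eq
... | inj₁ (w′ , refl , eq′) = f w′ h eq′ w≤n h≤n
... | inj₂ (h′ , refl , eq′) = Sum.swap (f h′ w (trans (*-comm h′ w) eq′) h≤n w≤n)

-- The shorter of two sides with product m² is at most `m`.
sidesIn-square : ∀ {L} m →
  (∀ u v → u * v ≡ m * m → u ≤ m → v ≤ n → u ∈ L) → SidesIn n (m * m) L
sidesIn-square m f w h eq w≤n h≤n with ≤-total w h
... | inj₁ w≤h = inj₁ (f w h eq (x*y≡m*m⇒x≤m w h m w≤h eq) h≤n)
... | inj₂ h≤w = inj₂ (f h w eq′ (x*y≡m*m⇒x≤m h w m h≤w eq′) w≤n)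
  where eq′ = trans (*-comm h w) eq

-- The geometric input of the arithmetic below; `side-bound` establishes it for perfect partitions.
SideBound : ℕ → ℕ → ℕ → Set
SideBound n A k = ∀ L → SidesIn n A L → k ≤ length L

2≤q<p⇒6≤p*q : 2 ≤ q → q < p → 6 ≤ p * q
2≤q<p⇒6≤p*q 2≤q q<p = *-mono-≤ (≤-trans (s≤s 2≤q) q<p) 2≤q

semiprime-ordered : Prime p → Prime q →
  ∃[ p′ ] ∃[ q′ ] (Prime p′ × Prime q′ × q′ ≤ p′ × p * q ≡ p′ * q′)
semiprime-ordered {p} {q} pp pq with ≤-total p q
... | inj₁ p≤q = q , p , pq , pp , p≤q , *-comm p q
... | inj₂ q≤p = p , q , pp , pq , q≤p , refl

bound-prime-1 : Prime r → Prime p → SideBound (r * p) (r * (p * p)) r → r ≤ 3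
bound-prime-1 {r} {p} pr pp bound = m≤n⇒m≤1+n (bound (map (r *_) (p ∷ 1 ∷ [])) (sidesIn-prime _ pr λ u v eq u≤ _ →
  inj₁ (∈-map⁺ (r *_) (small-divisor-prime-square u v pp eq (*-cancelˡ-≤ r {{prime⇒nonZero pr}} u≤)))))

-- For p = q there are three candidates for the side r u. Otherwise there are five, so r ≤ 5 < 6 ≤
-- pq. Then u = 1 would make the other side (pq)², longer than r p q. Four candidates remain, and 4
-- is not prime.
bound-prime-2 : Prime r → Prime p → Prime q → q ≤ p →
  SideBound (r * (p * q)) (r * ((p * q) * (p * q))) r → r ≤ 3
bound-prime-2 {r} {p} {q} pr pp pq q≤p bound with m≤n⇒m<n∨m≡n q≤p
... | inj₂ refl = bound (map (r *_) (p * p ∷ p ∷ 1 ∷ [])) (sidesIn-prime _ pr λ u v eq u≤ _ →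
        inj₁ (∈-map⁺ (r *_) (small-divisor-prime-fourth-power u v pp eq
          (*-cancelˡ-≤ r {{prime⇒nonZero pr}} u≤))))
... | inj₁ q<p = prime≤4⇒≤3 pr r≤4
  where
  instance
    _ = prime⇒nonZero pr
    _ = prime⇒nonZero pp
    _ = prime⇒nonZero pq
    _ = m*n≢0 p q

  classify : ∀ u v → u * v ≡ (p * q) * (p * q) → r * u ≤ r * (p * q) → u ∈ p * q ∷ p ∷ q ∷ q * q ∷ 1 ∷ []
  classify u v eq u≤ = small-divisor-semiprime-square u v pp pq q≤p eq (*-cancelˡ-≤ r u≤)

  r≤5 : r ≤ 5
  r≤5 = bound (map (r *_) (p * q ∷ p ∷ q ∷ q * q ∷ 1 ∷ []))
          (sidesIn-prime _ pr λ u v eq u≤ _ → inj₁ (∈-map⁺ (r *_) (classify u v eq u≤)))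

  no-1 : ∀ v → 1 * v ≡ (p * q) * (p * q) → ¬ (v ≤ r * (p * q))
  no-1 v eq v≤ = <⇒≱ (s≤s r≤5) (≤-trans (2≤q<p⇒6≤p*q (prime⇒2≤ pq) q<p)
                 (≤-trans (cofactor-bound (p * q) 1 v r eq v≤) (≤-reflexive (*-identityˡ r))))

  prune : ∀ u v → u * v ≡ (p * q) * (p * q) → v ≤ r * (p * q) →
          u ∈ p * q ∷ p ∷ q ∷ q * q ∷ 1 ∷ [] → u ∈ p * q ∷ p ∷ q ∷ q * q ∷ []
  prune u v _  _  (here e)                                  = here e
  prune u v _  _  (there (here e))                          = there (here e)
  prune u v _  _  (there (there (here e)))                  = there (there (here e))
  prune u v _  _  (there (there (there (here e))))          = there (there (there (here e)))
  prune u v eq v≤ (there (there (there (there (here refl))))) = contradiction v≤ (no-1 v eq)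

  r≤4 : r ≤ 4
  r≤4 = bound (map (r *_) (p * q ∷ p ∷ q ∷ q * q ∷ []))
          (sidesIn-prime _ pr λ u v eq u≤ v≤ → inj₁ (∈-map⁺ (r *_) (prune u v eq v≤ (classify u v eq u≤))))

-- For q < p the five candidates give r² ≤ 5, so r = 2. A side 1 would then need pq ≤ r and a side q
-- would need p ≤ r, both impossible since p ≥ 3. Three candidates remain.
bound-prime-square : Prime r → Prime p → Prime q → q ≤ p →
  SideBound (r * (p * q)) ((p * q) * (p * q)) (r * r) → r * r ≤ 3
bound-prime-square {r} {p} {q} pr pp pq q≤p bound with m≤n⇒m<n∨m≡n q≤p
... | inj₂ refl = bound (p * p ∷ p ∷ 1 ∷ []) (sidesIn-square (p * p) λ u v eq u≤ _ →
        small-divisor-prime-fourth-power u v pp eq u≤)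
... | inj₁ q<p = bound (p * q ∷ p ∷ q * q ∷ [])
        (sidesIn-square (p * q) λ u v eq u≤ v≤ → prune u v eq v≤ (classify u v eq u≤))
  where
  instance
    _ = prime⇒nonZero pp
    _ = prime⇒nonZero pq
    _ = m*n≢0 p q

  classify : ∀ u v → u * v ≡ (p * q) * (p * q) → u ≤ p * q → u ∈ p * q ∷ p ∷ q ∷ q * q ∷ 1 ∷ []
  classify u v = small-divisor-semiprime-square u v pp pq q≤p

  3≤p : 3 ≤ p
  3≤p = ≤-trans (s≤s (prime⇒2≤ pq)) q<p

  r≤2 : r ≤ 2
  r≤2 = ≮⇒≥ λ 3≤r → <⇒≱ (≤-trans (m≤n+m 6 3) (*-mono-≤ 3≤r 3≤r))
          (bound (p * q ∷ p ∷ q ∷ q * q ∷ 1 ∷ []) (sidesIn-square (p * q) λ u v eq u≤ _ → classify u v eq u≤))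

  no-1 : ∀ v → 1 * v ≡ (p * q) * (p * q) → ¬ (v ≤ r * (p * q))
  no-1 v eq v≤ = <⇒≱ (≤-trans (s≤s r≤2) (m≤n+m 3 3)) (≤-trans (2≤q<p⇒6≤p*q (prime⇒2≤ pq) q<p)
                 (≤-trans (cofactor-bound (p * q) 1 v r eq v≤) (≤-reflexive (*-identityˡ r))))

  no-q : ∀ v → q * v ≡ (p * q) * (p * q) → ¬ (v ≤ r * (p * q))
  no-q v eq v≤ = <⇒≱ 3≤p (≤-trans (*-cancelˡ-≤ q (subst (_≤ q * r) (*-comm p q) (cofactor-bound (p * q) q v r eq v≤))) r≤2)

  prune : ∀ u v → u * v ≡ (p * q) * (p * q) → v ≤ r * (p * q) →
          u ∈ p * q ∷ p ∷ q ∷ q * q ∷ 1 ∷ [] → u ∈ p * q ∷ p ∷ q * q ∷ []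
  prune u v _  _  (here e)                                  = here e
  prune u v _  _  (there (here e))                          = there (here e)
  prune u v eq v≤ (there (there (here refl)))               = contradiction v≤ (no-q v eq)
  prune u v _  _  (there (there (there (here e))))          = there (there (here e))
  prune u v eq v≤ (there (there (there (there (here refl))))) = contradiction v≤ (no-1 v eq)

-- One side is r u with u dividing s t². If s is taken out of u, the rest divides t² and is at most
-- t, which leaves t and 1. Otherwise u divides t², which leaves 1, t and t².
bound-two-primes : Prime r → Prime s → Prime t →
  SideBound (r * (s * t)) (r * (s * (t * t))) (r * s) → r * s ≤ 5
bound-two-primes {r} {s} {t} pr ps pt bound =
  bound (r * s ∷ r * (s * t) ∷ r ∷ r * t ∷ r * (t * t) ∷ []) (sidesIn-prime _ pr λ u v eq u≤ _ → inj₁ (sides u v eq u≤))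
  where
  instance
    _ = prime⇒nonZero pr
    _ = prime⇒nonZero ps
  sides : ∀ u v → u * v ≡ s * (t * t) → r * u ≤ r * (s * t) →
          r * u ∈ r * s ∷ r * (s * t) ∷ r ∷ r * t ∷ r * (t * t) ∷ []
  sides u v eq u≤ with prime-split u v (t * t) ps eq
  ... | inj₁ (u′ , refl , eq′) with small-divisor-prime-square u′ v pt eq′ (*-cancelˡ-≤ s (*-cancelˡ-≤ r u≤))
  ...   | here refl         = there (here refl)
  ...   | there (here refl) = here (cong (r *_) (*-identityʳ s))
  sides u v eq u≤ | inj₂ (v₁ , refl , eq′)
    with prime-square-split u v₁ 1 pt (trans eq′ (cong (t *_) (sym (*-identityʳ t))))
  ... | u′ , v′ , eq″ , c with refl ← m*n≡1⇒m≡1 u′ v′ eq″ with c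
  ...   | inj₁ refl        = there (there (here (*-identityʳ r)))
  ...   | inj₂ (inj₁ refl) = there (there (there (here (cong (r *_) (*-identityʳ t)))))
  ...   | inj₂ (inj₂ refl) = there (there (there (there (here (cong (λ z → r * (t * z)) (*-identityʳ t))))))

-- A prime `a` of the area divides one side, so the other side is a subproduct of the remaining
-- primes. There are fewer than `2 ^ length ks` of these in the list, while `product ks` is at least
-- that power.
bound-few-divisors : ∀ {ks as} → All Prime ks → All Prime as → length as ≤ length ks →
  2 ≤ product ks → ¬ SideBound n (product as) (product ks)
bound-few-divisors {as = []} pks [] _ 2≤k bound =
  <⇒≱ 2≤k (bound (1 ∷ []) λ w h eq _ _ → inj₁ (here (m*n≡1⇒m≡1 w h eq)))
bound-few-divisors {ks = ks} {a ∷ as} pks (pa ∷ pas) le _ bound = <⇒≱ (begin-strict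
  length (divisors as)  ≡⟨ length-divisors as ⟩
  2 ^ length as         <⟨ ^-monoʳ-< 2 ≤-refl le ⟩
  2 ^ length ks         ≤⟨ 2^length≤product pks ⟩
  product ks            ∎)
  (bound (divisors as) (sidesIn-prime _ pa λ u v eq _ _ →
    inj₂ (divisor∈divisors v u pas (trans (*-comm v u) eq))))
  where open ≤-Reasoning

-- Cases by the number of prime factors of k

6≤product-distinct : Prime r → Prime s → r ≢ s → 6 ≤ r * s
6≤product-distinct {r} {s} pr ps r≢s with ≤-total r s
... | inj₁ r≤s = subst (6 ≤_) (*-comm s r) (2≤q<p⇒6≤p*q (prime⇒2≤ pr) (≤∧≢⇒< r≤s r≢s))
... | inj₂ s≤r = 2≤q<p⇒6≤p*q (prime⇒2≤ ps) (≤∧≢⇒< s≤r (r≢s ∘ sym))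

-- Cancelling `r` in r A = (r m)² gives A = r m², where m has one or two prime factors.
bound-Ω-1 : ∀ {A qs} → Prime r → All Prime qs → 1 ≤ length qs → length qs ≤ 2 →
  r * A ≡ (r * product qs) * (r * product qs) → SideBound (r * product qs) A r → r ≤ 3
bound-Ω-1 {r} {A} {qs} pr pqs 1≤ ≤2 eq bound = go pqs 1≤ ≤2 (subst (λ A → SideBound _ A r) A≡ bound)
  where
  A≡ : A ≡ r * (product qs * product qs)
  A≡ = *-cancelˡ-≡ _ _ r {{prime⇒nonZero pr}} (trans eq (lemma r (product qs)))
    where
    lemma : ∀ r m → (r * m) * (r * m) ≡ r * (r * (m * m))
    lemma = solve-∀

  go : ∀ {qs} → All Prime qs → 1 ≤ length qs → length qs ≤ 2 →
       SideBound (r * product qs) (r * (product qs * product qs)) r → r ≤ 3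
  go {p ∷ []} (pp ∷ []) _ _ b =
    bound-prime-1 pr pp (subst (λ m → SideBound (r * m) (r * (m * m)) r) (*-identityʳ p) b)
  go {p ∷ q ∷ []} (pp ∷ pq ∷ []) _ _ b with semiprime-ordered pp pq
  ... | p′ , q′ , pp′ , pq′ , q′≤p′ , pq≡ = bound-prime-2 pr pp′ pq′ q′≤p′
    (subst (λ m → SideBound (r * m) (r * (m * m)) r) (trans (cong (p *_) (*-identityʳ q)) pq≡) b)
  go {_ ∷ _ ∷ _ ∷ _} _ _ (s≤s (s≤s ()))

-- For r = s, cancelling r² leaves A = (pq)². For r ≠ s, the prime `s` must come from pq, so n = r s
-- t, and the bound r s ≤ 5 contradicts r s ≥ 6.
bound-Ω-2 : ∀ {A} → Prime r → Prime s → Prime p → Prime q →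
  r * s * A ≡ (r * (p * q)) * (r * (p * q)) → SideBound (r * (p * q)) A (r * s) → r * s ≤ 3
bound-Ω-2 {r} {s} {p} {q} {A} pr ps pp pq eq bound with r ≟ s
... | yes refl with semiprime-ordered pp pq
...   | p′ , q′ , pp′ , pq′ , q′≤p′ , pq≡ = bound-prime-square pr pp′ pq′ q′≤p′
          (subst (λ m → SideBound (r * m) (m * m) (r * r)) pq≡ (subst (λ A → SideBound _ A (r * r)) A≡ bound))
  where
  instance
    _ = prime⇒nonZero pr
    _ = m*n≢0 r r
  A≡ : A ≡ (p * q) * (p * q)
  A≡ = *-cancelˡ-≡ _ _ (r * r) (trans eq (lemma r (p * q)))
    where
    lemma : ∀ r m → (r * m) * (r * m) ≡ r * r * (m * m)
    lemma = solve-∀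
bound-Ω-2 {r} {s} {p} {q} {A} pr ps pp pq eq bound | no r≢s =
  let t , pt , pq≡ = cofactor in
  contradiction (bound-two-primes pr ps pt
    (subst (λ A → SideBound (r * (s * t)) A (r * s)) (A≡ t pq≡) (subst (λ m → SideBound (r * m) A (r * s)) pq≡ bound)))
    (<⇒≱ (6≤product-distinct pr ps r≢s))
  where
  instance
    _ = prime⇒nonZero pr
    _ = prime⇒nonZero ps
    _ = m*n≢0 r s

  s∣n² : s ∣ (r * (p * q)) * (r * (p * q))
  s∣n² = subst (s ∣_) eq (∣-trans (divides r refl) (m∣m*n A))

  s∣pq : s ∣ p * q
  s∣pq = [ (λ s∣r → contradiction (sym (prime∣prime⇒≡ ps pr s∣r)) r≢s) , id ]′
           (euclidsLemma r (p * q) ps (prime∣square⇒∣ (r * (p * q)) ps s∣n²))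

  A≡ : ∀ t → p * q ≡ s * t → A ≡ r * (s * (t * t))
  A≡ t pq≡ = *-cancelˡ-≡ _ _ (r * s)
    (trans eq (trans (cong (λ m → (r * m) * (r * m)) pq≡) (lemma r s t)))
    where
    lemma : ∀ r s t → (r * (s * t)) * (r * (s * t)) ≡ r * s * (r * (s * (t * t)))
    lemma = solve-∀

  cofactor : ∃[ t ] (Prime t × p * q ≡ s * t)
  cofactor with euclidsLemma p q ps s∣pq
  ... | inj₁ s∣p = q , pq , cong (_* q) (sym (prime∣prime⇒≡ ps pp s∣p))
  ... | inj₂ s∣q = p , pp , trans (*-comm p q) (cong (_* p) (sym (prime∣prime⇒≡ ps pq s∣q)))

at-most-3-tiles : ∀ {k A ns} → All Prime ns → 2 ≤ length ns → length ns ≤ 3 → 2 ≤ k →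
  k * A ≡ product ns * product ns → SideBound (product ns) A k → k ≤ 3
at-most-3-tiles {k} {A} {ns} pns 2≤Ω Ω≤3 2≤k eq bound
  with product-split k A (All.++⁺ pns pns) (trans eq (sym (product-++ ns ns)))
... | ks , as , pks , pas , refl , refl , len = go ks pks 2≤k eq bound (trans len (length-++ ns))
  where
  go : ∀ ks → All Prime ks → 2 ≤ product ks → product ks * product as ≡ product ns * product ns →
       SideBound (product ns) (product as) (product ks) →
       length ks + length as ≡ length ns + length ns → product ks ≤ 3
  go [] _ (s≤s ())
  go (r ∷ []) (pr ∷ []) _ eq bound _
    with extract-prime pr pns (prime∣square⇒∣ _ pr (subst (r ∣_) eq (∣-trans (m∣m*n 1) (m∣m*n (product as)))))
  ... | qs , pqs , n≡ , Ω≡ = ≤-trans (≤-reflexive (*-identityʳ r))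
    (bound-Ω-1 pr pqs (≤-pred (subst (2 ≤_) Ω≡ 2≤Ω)) (≤-pred (subst (_≤ 3) Ω≡ Ω≤3))
      (trans (cong (_* product as) (sym (*-identityʳ r))) (trans eq (cong (λ n → n * n) n≡)))
      (subst₂ (λ n k → SideBound n (product as) k) n≡ (*-identityʳ r) bound))
  go (r ∷ s ∷ []) (pr ∷ ps ∷ []) 2≤k eq bound len
    with extract-prime pr pns (prime∣square⇒∣ _ pr (subst (r ∣_) eq (∣-trans (m∣m*n (s * 1)) (m∣m*n (product as)))))
  ... | [] , _ , _ , Ω≡ = contradiction (subst (2 ≤_) Ω≡ 2≤Ω) λ { (s≤s ()) }
  -- Here n and k have two prime factors each, hence so has A.
  ... | _ ∷ [] , _ , _ , Ω≡ = contradiction bound (bound-few-divisors (pr ∷ ps ∷ []) pas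
    (≤-reflexive (+-cancelˡ-≡ 2 _ _ (trans len (cong (λ l → l + l) Ω≡)))) 2≤k)
  ... | p ∷ q ∷ [] , pp ∷ pq ∷ [] , n≡ , _ =
    subst (_≤ 3) (sym k≡) (bound-Ω-2 pr ps pp pq
      (trans (cong (_* product as) (sym k≡)) (trans eq (cong (λ n → n * n) n≡′)))
      (subst₂ (λ n k → SideBound n (product as) k) n≡′ k≡ bound))
    where
    k≡  = cong (r *_) (*-identityʳ s)
    n≡′ = trans n≡ (cong (λ z → r * (p * z)) (*-identityʳ q))
  ... | _ ∷ _ ∷ _ ∷ _ , _ , _ , Ω≡ = contradiction (subst (_≤ 3) Ω≡ Ω≤3) λ { (s≤s (s≤s (s≤s ()))) }
  -- Since Ω(k) + Ω(A) = 2 Ω(n) ≤ 6, three primes in k leave at most three for A.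
  go (a ∷ b ∷ c ∷ ks) pks 2≤k _ bound len =
    contradiction bound (bound-few-divisors pks pas (≤-trans Ωas≤3 (m≤m+n 3 (length ks))) 2≤k)
    where
    Ωas≤3 : length as ≤ 3
    Ωas≤3 = +-cancelˡ-≤ 3 _ _ (begin
      3 + length as                ≤⟨ +-monoˡ-≤ (length as) (m≤m+n 3 (length ks)) ⟩
      3 + length ks + length as    ≡⟨ len ⟩
      length ns + length ns        ≤⟨ +-mono-≤ Ω≤3 Ω≤3 ⟩
      6                            ∎)
      where open ≤-Reasoning

-- Reflection in the diagonal

transposeRect : Rectangle → Rectangle
transposeRect R = record
  { left = bottom R ; bottom = left R ; width = height R ; height = width R
  ; 0<width = 0<height R ; 0<height = 0<width R }

-- Carries results on horizontal strips over to vertical ones.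
transpose : ∀ {n} → MondrianPartition n → MondrianPartition n
transpose P = record
  { k              = k
  ; 2≤k            = 2≤k
  ; tile           = transposeRect ∘ tile
  ; inSquare       = λ i → swap (inSquare i)
  ; covers         = λ x y x<n y<n → let i , c = covers y x y<n x<n in i , swap c
  ; nonOverlapping = λ i j i≢j x y (c , d) → nonOverlapping i j i≢j y x (swap c , swap d)
  ; nonCongruent   = λ i j i≢j → nonCongruent i j i≢j ∘ Sum.map swap swap
  }
  where open MondrianPartition P

transpose-perfect : ∀ {n} (P : MondrianPartition n) → Perfect P → Perfect (transpose P)
transpose-perfect P perf i j =
  trans (*-comm (height (tile i)) _) (trans (perf i j) (*-comm (width (tile j)) _))
  where open MondrianPartition P

-- Congruence and cell counting in a perfect partition

offset< : ∀ {c x d} → c ≤ x → x < c + d → x ∸ c < d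
offset< {c} {x} {d} c≤x x<c+d = subst (x ∸ c <_) (m+n∸m≡n c d) (∸-monoˡ-< x<c+d c≤x)

fromℕ<-offset-injective : ∀ {c d x x′} (p : c ≤ x) (q : x < c + d) (p′ : c ≤ x′) (q′ : x′ < c + d) →
  fromℕ< (offset< p q) ≡ fromℕ< (offset< p′ q′) → x ≡ x′
fromℕ<-offset-injective {c} p q p′ q′ eq = ∸-cancelʳ-≡ p p′ (fromℕ<-injective _ _ (offset< p q) (offset< p′ q′) eq)

cast-injective : ∀ {m o} .(eq : m ≡ o) {i j : Fin m} → cast eq i ≡ cast eq j → i ≡ j
cast-injective eq {i} {j} e = toℕ-injective (trans (sym (Fin.toℕ-cast eq i)) (trans (cong toℕ e) (Fin.toℕ-cast eq j)))

module PerfectPartition {n} (P : MondrianPartition n) (perfect : Perfect P) where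
  open MondrianPartition P

  tile-unique : ∀ {x y} i j → CellIn x y (tile i) → CellIn x y (tile j) → i ≡ j
  tile-unique i j c d = decidable-stable (i Fin.≟ j) λ i≢j → nonOverlapping i j i≢j _ _ (c , d)

  congruent⇒≡ : ∀ {i j} → Congruent (tile i) (tile j) → i ≡ j
  congruent⇒≡ {i} {j} c = decidable-stable (i Fin.≟ j) λ i≢j → nonCongruent i j i≢j c

  tile₀ : Fin k
  tile₀ = fromℕ< (≤-trans (s≤s z≤n) 2≤k)

  A : ℕ
  A = area (tile tile₀)

  private
    w h l b : Fin k → ℕ
    w = width ∘ tile
    h = height ∘ tile
    l = left ∘ tile
    b = bottom ∘ tile

  area≡A : ∀ i → w i * h i ≡ A
  area≡A i = perfect i tile₀

  width≤n : ∀ i → w i ≤ n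
  width≤n i = ≤-trans (m≤n+m (w i) (l i)) (proj₁ (inSquare i))

  height≤n : ∀ i → h i ≤ n
  height≤n i = ≤-trans (m≤n+m (h i) (b i)) (proj₂ (inSquare i))

  -- As all areas agree, one common side forces the other sides to agree, so distinct tiles would be
  -- congruent.
  equal-width⇒≡ : ∀ {i j} → w i ≡ w j → i ≡ j
  equal-width⇒≡ {i} {j} eq = congruent⇒≡ (inj₁ (eq , *-cancelˡ-≡ _ _ (w i) {{>-nonZero (0<width (tile i))}}
    (trans (perfect i j) (cong (_* h j) (sym eq)))))

  equal-height⇒≡ : ∀ {i j} → h i ≡ h j → i ≡ j
  equal-height⇒≡ {i} {j} eq = congruent⇒≡ (inj₁ (*-cancelʳ-≡ _ _ (h i) {{>-nonZero (0<height (tile i))}}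
    (trans (perfect i j) (cong (w j *_) (sym eq))) , eq))

  width≡height⇒≡ : ∀ {i j} → w i ≡ h j → i ≡ j
  width≡height⇒≡ {i} {j} eq = congruent⇒≡ (inj₂ (eq , *-cancelˡ-≡ _ _ (w i) {{>-nonZero (0<width (tile i))}}
    (trans (perfect i j) (trans (*-comm (w j) (h j)) (cong (_* w j) (sym eq))))))

  -- Each tile is sent to the position in `L` of one of its sides. Tiles sent to the same position
  -- share a side length, possibly a width with a height, and so coincide.
  side-bound : SideBound n A k
  side-bound L sides = injective⇒≤ {f = λ i → position (listed i)} λ {i} {j} → inj (listed i) (listed j)
    where
    listed : ∀ i → w i ∈ L ⊎ h i ∈ L
    listed i = sides (w i) (h i) (area≡A i) (width≤n i) (height≤n i)

    position : ∀ {i} → w i ∈ L ⊎ h i ∈ L → Fin (length L)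
    position (inj₁ p) = index p
    position (inj₂ p) = index p

    same : ∀ {u v} (p : u ∈ L) (q : v ∈ L) → index p ≡ index q → u ≡ v
    same p q eq = trans (lookup-index p) (trans (cong (lookup L) eq) (sym (lookup-index q)))

    inj : ∀ {i j} (p : w i ∈ L ⊎ h i ∈ L) (q : w j ∈ L ⊎ h j ∈ L) → position {i} p ≡ position {j} q → i ≡ j
    inj (inj₁ p) (inj₁ q) eq = equal-width⇒≡ (same p q eq)
    inj (inj₁ p) (inj₂ q) eq = width≡height⇒≡ (same p q eq)
    inj (inj₂ p) (inj₁ q) eq = sym (width≡height⇒≡ (sym (same p q eq)))
    inj (inj₂ p) (inj₂ q) eq = equal-height⇒≡ (same p q eq)

  column : ∀ {x y} i → CellIn x y (tile i) → Fin (w i)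
  column i ((l≤x , x<r) , _) = fromℕ< (offset< l≤x x<r)

  row : ∀ {x y} i → CellIn x y (tile i) → Fin (h i)
  row i (_ , (b≤y , y<t)) = fromℕ< (offset< b≤y y<t)

  -- A cell is numbered by its tile and its offset there; the cast identifies the varying w h with
  -- the common area.
  encode-cell : ∀ {x y} i → CellIn x y (tile i) → Fin (k * A)
  encode-cell i c = combine i (cast (area≡A i) (combine (column i c) (row i c)))

  encode-cell-injective : ∀ {x y x′ y′} i j (c : CellIn x y (tile i)) (c′ : CellIn x′ y′ (tile j)) →
    encode-cell i c ≡ encode-cell j c′ → x ≡ x′ × y ≡ y′
  encode-cell-injective i j c@((p , q) , (s , t)) c′@((p′ , q′) , (s′ , t′)) eq
    with combine-injective i _ j _ eq
  ... | refl , eq₁ with combine-injective (column i c) (row i c) (column i c′) (row i c′) (cast-injective (area≡A i) eq₁)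
  ...   | eqx , eqy = fromℕ<-offset-injective p q p′ q′ eqx , fromℕ<-offset-injective s t s′ t′ eqy

  -- By covering, every cell of the square has such a number, and the number determines the cell.
  n*n≤k*A : n * n ≤ k * A
  n*n≤k*A = injective⇒≤ {f = f} f-injective
    where
    cover : (c : Fin (n * n)) → let x , y = remQuot {n} n c in ∃[ i ] CellIn (toℕ x) (toℕ y) (tile i)
    cover c = covers _ _ (toℕ<n (proj₁ (remQuot {n} n c))) (toℕ<n (proj₂ (remQuot {n} n c)))

    f : Fin (n * n) → Fin (k * A)
    f c = encode-cell (proj₁ (cover c)) (proj₂ (cover c))

    f-injective : ∀ {c d} → f c ≡ f d → c ≡ d
    f-injective {c} {d} eq with eqx , eqy ← encode-cell-injective _ _ (proj₂ (cover c)) (proj₂ (cover d)) eq = begin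
      c                                      ≡⟨ combine-remQuot {n} n c ⟨
      uncurry combine (remQuot {n} n c)      ≡⟨ cong₂ combine (toℕ-injective eqx) (toℕ-injective eqy) ⟩
      uncurry combine (remQuot {n} n d)      ≡⟨ combine-remQuot {n} n d ⟩
      d                                      ∎
      where open ≡-Reasoning

  -- Conversely, a tile and an offset name a cell inside the square, and non-overlap recovers the
  -- tile from the cell.
  k*A≤n*n : k * A ≤ n * n
  k*A≤n*n = injective⇒≤ {f = f} f-injective
    where
    tileOf : Fin (k * A) → Fin k
    tileOf c = proj₁ (remQuot {k} A c)

    cell : (c : Fin (k * A)) → Fin (w (tileOf c)) × Fin (h (tileOf c))
    cell c = remQuot (h (tileOf c)) (cast (sym (area≡A (tileOf c))) (proj₂ (remQuot {k} A c)))

    X Y : Fin (k * A) → ℕ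
    X c = l (tileOf c) + toℕ (proj₁ (cell c))
    Y c = b (tileOf c) + toℕ (proj₂ (cell c))

    cell∈ : ∀ c → CellIn (X c) (Y c) (tile (tileOf c))
    cell∈ c = (m≤m+n _ _ , +-monoʳ-< _ (toℕ<n (proj₁ (cell c)))) , (m≤m+n _ _ , +-monoʳ-< _ (toℕ<n (proj₂ (cell c))))

    X<n : ∀ c → X c < n
    X<n c = <-≤-trans (proj₂ (proj₁ (cell∈ c))) (proj₁ (inSquare (tileOf c)))

    Y<n : ∀ c → Y c < n
    Y<n c = <-≤-trans (proj₂ (proj₂ (cell∈ c))) (proj₂ (inSquare (tileOf c)))

    f : Fin (k * A) → Fin (n * n)
    f c = combine (fromℕ< (X<n c)) (fromℕ< (Y<n c))

    decode : (i : Fin k) → Fin (w i) × Fin (h i) → Fin (k * A)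
    decode i (dx , dy) = combine i (cast (area≡A i) (combine dx dy))

    decode-cell : ∀ c → decode (tileOf c) (cell c) ≡ c
    decode-cell c = trans (cong (combine (tileOf c))
      (trans (cong (cast (area≡A (tileOf c))) (combine-remQuot {w (tileOf c)} (h (tileOf c)) _))
             (Fin.cast-involutive (area≡A (tileOf c)) (sym (area≡A (tileOf c))) _)))
      (combine-remQuot {k} A c)

    -- The types of the offsets depend on the tile, so the equality of tiles is matched before the
    -- offsets are compared.
    decode-cong : ∀ {i j} (c : Fin (w i) × Fin (h i)) (d : Fin (w j) × Fin (h j)) → i ≡ j →
      l i + toℕ (proj₁ c) ≡ l j + toℕ (proj₁ d) → b i + toℕ (proj₂ c) ≡ b j + toℕ (proj₂ d) →
      decode i c ≡ decode j d
    decode-cong {i} c d refl eqx eqy = cong₂ (λ dx dy → decode i (dx , dy))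
      (toℕ-injective (+-cancelˡ-≡ (l i) _ _ eqx)) (toℕ-injective (+-cancelˡ-≡ (b i) _ _ eqy))

    f-injective : ∀ {c d} → f c ≡ f d → c ≡ d
    f-injective {c} {d} eq with eqx , eqy ← combine-injective (fromℕ< (X<n c)) (fromℕ< (Y<n c)) (fromℕ< (X<n d)) (fromℕ< (Y<n d)) eq =
      trans (sym (decode-cell c)) (trans (decode-cong (cell c) (cell d) i≡j X≡ Y≡) (decode-cell d))
      where
      X≡ : X c ≡ X d
      X≡ = fromℕ<-injective _ _ (X<n c) (X<n d) eqx
      Y≡ : Y c ≡ Y d
      Y≡ = fromℕ<-injective _ _ (Y<n c) (Y<n d) eqy
      i≡j : tileOf c ≡ tileOf d
      i≡j = tile-unique _ _ (cell∈ c)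
        (subst₂ (λ x y → CellIn x y (tile (tileOf d))) (sym X≡) (sym Y≡) (cell∈ d))

  k*A≡n*n : k * A ≡ n * n
  k*A≡n*n = ≤-antisym k*A≤n*n n*n≤k*A

  -- Full-width tiles

  -- Index of the last row and column of cells; it is n - 1 because n is positive.
  N : ℕ
  N = pred n

  corner-cell : ∀ i → CellIn (l i) (b i) (tile i)
  corner-cell i = (≤-refl , m<m+n _ (0<width (tile i))) , (≤-refl , m<m+n _ (0<height (tile i)))

  left<n : ∀ i → l i < n
  left<n i = <-≤-trans (proj₂ (proj₁ (corner-cell i))) (proj₁ (inSquare i))

  bottom<n : ∀ i → b i < n
  bottom<n i = <-≤-trans (proj₂ (proj₂ (corner-cell i))) (proj₂ (inSquare i))

  N<n : N < n
  N<n = ≤-reflexive (suc-pred n {{>-nonZero (≤-trans (s≤s z≤n) (left<n tile₀))}})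

  0<n : 0 < n
  0<n = ≤-trans (s≤s z≤n) N<n

  <n⇒≤N : ∀ {y} → y < n → y ≤ N
  <n⇒≤N y<n = ≤-pred (≤-trans y<n (≤-reflexive (sym (suc-pred n {{>-nonZero 0<n}}))))

  FullWidth : Fin k → Set
  FullWidth i = l i ≡ 0 × w i ≡ n

  RowIn : ℕ → Fin k → Set
  RowIn y i = b i ≤ y × y < b i + h i

  -- The two cells may lie in different rows, so the lemma also applies to opposite corners.
  full-width : ∀ {y y′} i → CellIn 0 y (tile i) → CellIn N y′ (tile i) → FullWidth i
  full-width i ((l≤0 , _) , _) ((_ , N<r) , _) =
    l≡0 , ≤-antisym (width≤n i) (≤-trans (≤-reflexive (sym (suc-pred n {{>-nonZero 0<n}})))
                                         (subst (λ z → N < z + w i) l≡0 N<r))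
    where l≡0 = n≤0⇒n≡0 l≤0

  full-width-unique : ∀ i j → FullWidth i → FullWidth j → i ≡ j
  full-width-unique i j (_ , wi) (_ , wj) = equal-width⇒≡ (trans wi (sym wj))

  row-cell : ∀ {x y} i → FullWidth i → x < n → RowIn y i → CellIn x y (tile i)
  row-cell {x} i (l≡0 , w≡n) x<n y∈i =
    (subst (_≤ x) (sym l≡0) z≤n , subst₂ (λ l w → x < l + w) (sym l≡0) (sym w≡n) x<n) , y∈i

  row-unique : ∀ {x y} i j → FullWidth i → RowIn y i → CellIn x y (tile j) → j ≡ i
  row-unique i j full y∈i c@((_ , x<r) , _) =
    tile-unique j i c (row-cell i full (<-≤-trans x<r (proj₁ (inSquare j))) y∈i)

  -- Such a tile would fill the square, so tiles 0 and 1 would both equal it.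
  ¬all-rows : ∀ i → FullWidth i → ¬ (∀ y → y < n → RowIn y i)
  ¬all-rows i full rows = contradiction
    (fromℕ<-injective 0 1 _ 2≤k (trans (only tile₀) (sym (only (fromℕ< 2≤k))))) λ ()
    where
    only : ∀ j → j ≡ i
    only j = row-unique i j full (rows _ (bottom<n j)) (corner-cell j)

  top-row : ∀ i → RowIn (b i + pred (h i)) i
  top-row i = m≤m+n _ _ , +-monoʳ-< (b i) (≤-reflexive (suc-pred (h i) {{>-nonZero (0<height (tile i))}}))

  -- Impossibility of at most three tiles

  module AtMostThree (k≤3 : k ≤ 3) where

    pigeonhole₄ : (c₀ c₁ c₂ c₃ : Fin k) →
      c₀ ≡ c₁ ⊎ c₀ ≡ c₂ ⊎ c₀ ≡ c₃ ⊎ c₁ ≡ c₂ ⊎ c₁ ≡ c₃ ⊎ c₂ ≡ c₃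
    pigeonhole₄ c₀ c₁ c₂ c₃ with pigeonhole (s≤s k≤3) (Vec.lookup (c₀ ∷ c₁ ∷ c₂ ∷ c₃ ∷ []))
    ... | zero         , suc zero             , _ , eq = inj₁ eq
    ... | zero         , suc (suc zero)       , _ , eq = inj₂ (inj₁ eq)
    ... | zero         , suc (suc (suc zero)) , _ , eq = inj₂ (inj₂ (inj₁ eq))
    ... | suc zero     , suc (suc zero)       , _ , eq = inj₂ (inj₂ (inj₂ (inj₁ eq)))
    ... | suc zero     , suc (suc (suc zero)) , _ , eq = inj₂ (inj₂ (inj₂ (inj₂ (inj₁ eq))))
    ... | suc (suc zero) , suc (suc (suc zero)) , _ , eq = inj₂ (inj₂ (inj₂ (inj₂ (inj₂ eq))))
    -- `pigeonhole` returns its two indices in increasing order; the remaining pairs violate this.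
    ... | suc zero , suc zero , s≤s () , _
    ... | suc (suc zero) , suc zero , s≤s () , _
    ... | suc (suc zero) , suc (suc zero) , s≤s (s≤s ()) , _
    ... | suc (suc (suc zero)) , suc zero , s≤s () , _
    ... | suc (suc (suc zero)) , suc (suc zero) , s≤s (s≤s ()) , _
    ... | suc (suc (suc zero)) , suc (suc (suc zero)) , s≤s (s≤s (s≤s ())) , _

    -- The rows outside the full-width tile i are y₀, …, y₁. A tile meeting both
    -- vertical sides of that rectangle would have width n, hence be congruent to
    -- i; so the at most two remaining tiles share it as a left and a right part
    -- of equal height, and are congruent to each other.
    ¬full-width-strip : ∀ i y₀ y₁ → FullWidth i → y₀ < n → y₁ < n →
      ¬ RowIn y₀ i → ¬ RowIn y₁ i → (∀ y → y < n → RowIn y i ⊎ (y₀ ≤ y × y ≤ y₁)) → ⊥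
    ¬full-width-strip i y₀ y₁ full y₀<n y₁<n y₀∉i y₁∉i rest = conclude
      where
      ≢i : ∀ {x y} j → ¬ RowIn y i → CellIn x y (tile j) → i ≢ j
      ≢i j y∉i (_ , y∈j) refl = y∉i y∈j

      ¬spans : ∀ {y y′} j → i ≢ j → CellIn 0 y (tile j) → CellIn N y′ (tile j) → ⊥
      ¬spans j i≢j c d = i≢j (full-width-unique i j full (full-width j c d))

      row-rest : ∀ {x y} j → i ≢ j → CellIn x y (tile j) → y₀ ≤ y × y ≤ y₁
      row-rest {y = y} j i≢j c@(_ , (_ , y<t)) with rest y (<-≤-trans y<t (proj₂ (inSquare j)))
      ... | inj₁ y∈i = contradiction (sym (row-unique i j full y∈i c)) i≢j
      ... | inj₂ r   = r

      full-height : ∀ {x x′} j → i ≢ j → CellIn x y₀ (tile j) → CellIn x′ y₁ (tile j) →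
                    b j ≡ y₀ × b j + h j ≡ suc y₁
      full-height j i≢j (_ , (b≤y₀ , _)) (_ , (_ , y₁<t)) =
        ≤-antisym b≤y₀ (proj₁ (row-rest j i≢j (corner-cell j))) ,
        -- Upper edges are exclusive: the tile contains row `y₁`, so it ends at `suc y₁` or above,
        -- and its own topmost row is at most `y₁`.
        ≤-antisym (subst (_≤ suc y₁) (trans (sym (+-suc (b j) _)) (cong (b j +_) (suc-pred (h j) {{>-nonZero (0<height (tile j))}})))
          (s≤s (proj₂ (row-rest j i≢j (proj₁ (corner-cell j) , top-row j))))) y₁<t

      full-height-unique : ∀ {x x′ z z′} j j′ → i ≢ j → i ≢ j′ →
        CellIn x y₀ (tile j) → CellIn x′ y₁ (tile j) → CellIn z y₀ (tile j′) → CellIn z′ y₁ (tile j′) → j ≡ j′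
      full-height-unique j j′ i≢j i≢j′ c d c′ d′ with full-height j i≢j c d | full-height j′ i≢j′ c′ d′
      ... | b≡ , t≡ | b′≡ , t′≡ = equal-height⇒≡ (+-cancelˡ-≡ (b j) _ _
        (trans t≡ (trans (sym t′≡) (cong (_+ h j′) (trans b′≡ (sym b≡))))))

      conclude : ⊥
      conclude with covers 0 y₀ 0<n y₀<n | covers N y₀ N<n y₀<n | covers 0 y₁ 0<n y₁<n | covers N y₁ N<n y₁<n
      ... | j₀₀ , c₀₀ | j₁₀ , c₁₀ | j₀₁ , c₀₁ | j₁₁ , c₁₁ =
        -- The tile `i` meets no corner of the strip, and no tile contains both a left and a right
        -- corner. So the first pigeonhole leaves only `j₀₀ ≡ j₀₁` and the second only `j₁₀ ≡ j₁₁`: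
        -- two tiles of full strip height.
        first (pigeonhole₄ i j₀₀ j₁₀ j₀₁) (pigeonhole₄ i j₀₀ j₁₀ j₁₁)
        where
        n₀₀ = ≢i j₀₀ y₀∉i c₀₀
        n₁₀ = ≢i j₁₀ y₀∉i c₁₀
        n₀₁ = ≢i j₀₁ y₁∉i c₀₁
        n₁₁ = ≢i j₁₁ y₁∉i c₁₁

        j₀₀≢j₁₀ : j₀₀ ≢ j₁₀
        j₀₀≢j₁₀ refl = ¬spans j₀₀ n₀₀ c₀₀ c₁₀

        same-column : j₀₀ ≡ j₀₁ → j₁₀ ≡ j₁₁ → ⊥
        same-column refl refl = j₀₀≢j₁₀ (full-height-unique j₀₀ j₁₀ n₀₀ n₁₀ c₀₀ c₀₁ c₁₀ c₁₁)

        second : j₀₀ ≡ j₀₁ → i ≡ j₀₀ ⊎ i ≡ j₁₀ ⊎ i ≡ j₁₁ ⊎ j₀₀ ≡ j₁₀ ⊎ j₀₀ ≡ j₁₁ ⊎ j₁₀ ≡ j₁₁ → ⊥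
        second _ (inj₁ e)                             = n₀₀ e
        second _ (inj₂ (inj₁ e))                      = n₁₀ e
        second _ (inj₂ (inj₂ (inj₁ e)))               = n₁₁ e
        second _ (inj₂ (inj₂ (inj₂ (inj₁ e))))        = j₀₀≢j₁₀ e
        second _ (inj₂ (inj₂ (inj₂ (inj₂ (inj₁ refl))))) = ¬spans j₀₀ n₀₀ c₀₀ c₁₁
        second e (inj₂ (inj₂ (inj₂ (inj₂ (inj₂ e′))))) = same-column e e′

        first : i ≡ j₀₀ ⊎ i ≡ j₁₀ ⊎ i ≡ j₀₁ ⊎ j₀₀ ≡ j₁₀ ⊎ j₀₀ ≡ j₀₁ ⊎ j₁₀ ≡ j₀₁ →
                i ≡ j₀₀ ⊎ i ≡ j₁₀ ⊎ i ≡ j₁₁ ⊎ j₀₀ ≡ j₁₀ ⊎ j₀₀ ≡ j₁₁ ⊎ j₁₀ ≡ j₁₁ → ⊥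
        first (inj₁ e)                             _ = n₀₀ e
        first (inj₂ (inj₁ e))                      _ = n₁₀ e
        first (inj₂ (inj₂ (inj₁ e)))               _ = n₀₁ e
        first (inj₂ (inj₂ (inj₂ (inj₁ e))))        _ = j₀₀≢j₁₀ e
        first (inj₂ (inj₂ (inj₂ (inj₂ (inj₁ e))))) o = second e o
        first (inj₂ (inj₂ (inj₂ (inj₂ (inj₂ refl))))) _ = ¬spans j₁₀ n₁₀ c₀₁ c₁₀

    -- The tile starts at row 0, so it fills the square or leaves the rows from `b i + h i` to `N`.
    ¬bottom-strip : ∀ i → CellIn 0 0 (tile i) → CellIn N 0 (tile i) → ⊥
    ¬bottom-strip i c@(_ , (b≤0 , _)) d with m≤n⇒m<n∨m≡n (proj₂ (inSquare i))
    ... | inj₂ t≡n = ¬all-rows i (full-width i c d) λ y y<n →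
            ≤-trans b≤0 z≤n , subst (y <_) (sym t≡n) y<n
    ... | inj₁ t<n = ¬full-width-strip i (b i + h i) N (full-width i c d) t<n N<n
            (<-irrefl refl ∘ proj₂) (λ (_ , N<t) → <⇒≱ N<t (<n⇒≤N t<n)) rest
      where
      rest : ∀ y → y < n → RowIn y i ⊎ (b i + h i ≤ y × y ≤ N)
      rest y y<n with <-≤-connex y (b i + h i)
      ... | inj₁ y<t = inj₁ (≤-trans b≤0 z≤n , y<t)
      ... | inj₂ t≤y = inj₂ (t≤y , <n⇒≤N y<n)

    -- The tile reaches row `N`, so it fills the square or leaves the rows from 0 to `pred (b i)`.
    ¬top-strip : ∀ i → CellIn 0 N (tile i) → CellIn N N (tile i) → ⊥
    ¬top-strip i c@(_ , (_ , N<t)) d with m≤n⇒m<n∨m≡n (z≤n {b i})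
    ... | inj₂ 0≡b = ¬all-rows i (full-width i c d) λ y y<n →
            subst (_≤ y) 0≡b z≤n , ≤-<-trans (<n⇒≤N y<n) N<t
    ... | inj₁ 0<b = ¬full-width-strip i 0 (pred (b i)) (full-width i c d) 0<n (<-trans pb<b (bottom<n i))
            (<⇒≱ 0<b ∘ proj₁) (<⇒≱ pb<b ∘ proj₁) rest
      where
      pb<b : pred (b i) < b i
      pb<b = ≤-reflexive (suc-pred (b i) {{>-nonZero 0<b}})
      rest : ∀ y → y < n → RowIn y i ⊎ (0 ≤ y × y ≤ pred (b i))
      rest y y<n with <-≤-connex y (b i)
      ... | inj₁ y<b = inj₂ (z≤n , ≤-pred (≤-trans y<b (≤-reflexive (sym (suc-pred (b i) {{>-nonZero 0<b}})))))
      ... | inj₂ b≤y = inj₁ (b≤y , ≤-<-trans (<n⇒≤N y<n) N<t)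

¬at-most-3-tiles : ∀ {n} (P : MondrianPartition n) → Perfect P → ¬ (MondrianPartition.k P ≤ 3)
¬at-most-3-tiles {n} P perfect k≤3 =
  let i₀₀ , c₀₀ = covers 0 0 0<n 0<n
      i₁₀ , c₁₀ = covers N 0 N<n 0<n
      i₀₁ , c₀₁ = covers 0 N 0<n N<n
      i₁₁ , c₁₁ = covers N N N<n N<n
  in shared c₀₀ c₁₀ c₀₁ c₁₁ (pigeonhole₄ i₀₀ i₁₀ i₀₁ i₁₁)
  where
  open MondrianPartition P
  open PerfectPartition P perfect
  open AtMostThree k≤3
  module T = PerfectPartition.AtMostThree (transpose P) (transpose-perfect P perfect) k≤3

  shared : ∀ {i₀₀ i₁₀ i₀₁ i₁₁} →
    CellIn 0 0 (tile i₀₀) → CellIn N 0 (tile i₁₀) → CellIn 0 N (tile i₀₁) → CellIn N N (tile i₁₁) →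
    i₀₀ ≡ i₁₀ ⊎ i₀₀ ≡ i₀₁ ⊎ i₀₀ ≡ i₁₁ ⊎ i₁₀ ≡ i₀₁ ⊎ i₁₀ ≡ i₁₁ ⊎ i₀₁ ≡ i₁₁ → ⊥
  shared {i} c₀₀ c₁₀ _ _ (inj₁ refl) = ¬bottom-strip i c₀₀ c₁₀
  -- Two corners on a vertical side become a bottom pair after reflection.
  shared {i} (x , y) _ (z , w) _ (inj₂ (inj₁ refl)) = T.¬bottom-strip i (y , x) (w , z)
  -- A tile containing opposite corners also contains the other two: its column range and row range
  -- are recombined.
  shared {i} c₀₀@(_ , y) _ _ (x , _) (inj₂ (inj₂ (inj₁ refl))) = ¬bottom-strip i c₀₀ (x , y)
  shared {i₁₀ = i} _ c₁₀@(_ , y) (x , _) _ (inj₂ (inj₂ (inj₂ (inj₁ refl)))) = ¬bottom-strip i (x , y) c₁₀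
  shared {i₁₀ = i} _ (x , y) _ (z , w) (inj₂ (inj₂ (inj₂ (inj₂ (inj₁ refl))))) = T.¬top-strip i (y , x) (w , z)
  shared {i₀₁ = i} _ _ c₀₁ c₁₁ (inj₂ (inj₂ (inj₂ (inj₂ (inj₂ refl))))) = ¬top-strip i c₀₁ c₁₁

-- Combination of the arithmetic and the geometric bound

no-perfect-partition : ∀ {ns} → All Prime ns → 2 ≤ length ns → length ns ≤ 3 →
  (P : MondrianPartition (product ns)) → ¬ Perfect P
no-perfect-partition pns 2≤Ω Ω≤3 P perfect = ¬at-most-3-tiles P perfect
  (at-most-3-tiles pns 2≤Ω Ω≤3 (MondrianPartition.2≤k P) k*A≡n*n side-bound)
  where open PerfectPartition P perfect

mainTheorem10 : ∀ (n : ℕ) →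
    (∃[ p ] ∃[ q ] (Prime p × Prime q × n ≡ p * q))
    ⊎ (∃[ p ] ∃[ q ] ∃[ r ] (Prime p × Prime q × Prime r × n ≡ p * q * r)) →
    ¬ (∃[ P ] Perfect {n} P)
mainTheorem10 n (inj₁ (p , q , pp , pq , n≡)) =
  subst (λ n → ¬ (∃[ P ] Perfect {n} P)) (sym (trans n≡ (cong (p *_) (sym (*-identityʳ q)))))
    (uncurry (no-perfect-partition (pp ∷ pq ∷ []) ≤-refl (s≤s (s≤s z≤n))))
mainTheorem10 n (inj₂ (p , q , r , pp , pq , pr , n≡)) =
  subst (λ n → ¬ (∃[ P ] Perfect {n} P)) (sym (trans n≡ (lemma p q r)))
    (uncurry (no-perfect-partition (pp ∷ pq ∷ pr ∷ []) (s≤s (s≤s z≤n)) ≤-refl))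
  where
  lemma : ∀ p q r → p * q * r ≡ p * (q * (r * 1))
  lemma = solve-∀
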